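{- There exists a planar signed simple graph $(G,\sigma)$ whose fractional balanced chromatic number satisfies $\chi_{fb}(G,\sigma) > 2$.
   Context: A signed graph $(G,\sigma)$ is a graph $G$ together with a signature $\sigma: E(G)\to\{+,-\}$. A cycle is negative if it has an odd number of negative edges. A set of vertices is balanced if the subgraph it induces contains no negative cycle. For positive integers $p,q$, a balanced $(p,q)$-coloring of $(G,\sigma)$ is an assignment to each vertex of a set of $q$ colors from $\{1,\dots,p\}$ such that, for each color, the set of vertices receiving that color is balanced. The fractional balanced chromatic number $\chi_{fb}(G,\sigma)$ is the minimum of $p/q$ over all pairs $(p,q)$ for which a balanced $(p,q)$-coloring exists. A simple graph has no loops and no parallel edges. -}

module Defs where

open import Data.Nat using (ℕ; zero; suc; _+_; _*_; _<_; _≤_; _%_)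
open import Data.Bool using (Bool; true; false; if_then_else_)
open import Data.Fin using (Fin)
open import Data.Fin.Subset using (Subset; ∣_∣) renaming (_∈_ to _∈ₛ_)
open import Data.List using (List; []; _∷_; length; map)
open import Data.Nat.ListAction using (sum)
open import Data.List.Relation.Unary.All using (All)
open import Data.List.Relation.Unary.Unique.Propositional using (Unique)
open import Data.Product using (Σ; _×_; _,_; proj₁; proj₂; ∃)
open import Data.Sum using (_⊎_)
open import Relation.Binary.PropositionalEquality using (_≡_)
open import Function.Definitions using (Injective)
open import Data.Rational as ℚ using (ℚ; 0ℚ; 1ℚ)

-- A finite simple signed graph on vertex set Fin n.
-- Simple: adjacency is a symmetric irreflexive Boolean relation
-- (so no loops and no parallel edges).  neg u v = true means the
-- edge uv (if present) is negative; neg is symmetric.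
record SignedGraph (n : ℕ) : Set where
  field
    adj       : Fin n → Fin n → Bool
    neg       : Fin n → Fin n → Bool
    adj-sym   : ∀ u v → adj u v ≡ adj v u
    adj-irr   : ∀ u → adj u u ≡ false
    neg-sym   : ∀ u v → neg u v ≡ neg v u
open SignedGraph public

cycEdgesFrom : ∀ {A : Set} → A → List A → List (A × A)
cycEdgesFrom x0 []            = []
cycEdgesFrom x0 (a ∷ [])      = (a , x0) ∷ []
cycEdgesFrom x0 (a ∷ b ∷ r)   = (a , b) ∷ cycEdgesFrom x0 (b ∷ r)

cycEdges : ∀ {A : Set} → List A → List (A × A)
cycEdges []       = []
cycEdges (x ∷ xs) = cycEdgesFrom x (x ∷ xs)

IsCycleIn : ∀ {n} → SignedGraph n → (Fin n → Set) → List (Fin n) → Set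
IsCycleIn G S vs =
  (3 ≤ length vs) × Unique vs × All S vs
  × All (λ e → adj G (proj₁ e) (proj₂ e) ≡ true) (cycEdges vs)

negCount : ∀ {n} → SignedGraph n → List (Fin n) → ℕ
negCount G vs = sum (map (λ e → if neg G (proj₁ e) (proj₂ e) then 1 else 0) (cycEdges vs))

Balanced : ∀ {n} → SignedGraph n → (Fin n → Set) → Set
Balanced G S = ∀ vs → IsCycleIn G S vs → negCount G vs % 2 ≡ 0

BalancedColoring : ∀ {n} → SignedGraph n → ℕ → ℕ → Set
BalancedColoring {n} G p q =
  Σ (Fin n → Subset p) λ f →
    (∀ v → ∣ f v ∣ ≡ q) × (∀ (c : Fin p) → Balanced G (λ v → c ∈ₛ f v))

-- χ_fb(G,σ) > a/b : the infimum of p/q over balanced (p,q)-colorings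
-- (p,q positive) is at least a/b.
FracBalChromGe : ∀ {n} → SignedGraph n → ℕ → ℕ → Set
FracBalChromGe G a b =
  ∀ p q → 0 < p → 0 < q → BalancedColoring G p q → a * q ≤ p * b

FracBalChromGt2 : ∀ {n} → SignedGraph n → Set
FracBalChromGt2 G = Σ ℕ λ a → Σ ℕ λ b → (0 < b) × (2 * b < a) × FracBalChromGe G a b

-- Planarity, via a straight-line drawing with rational coordinates
-- (equivalent to planarity by Fáry's theorem plus a small perturbation).
Point : Set
Point = ℚ × ℚ

OnSeg : Point → Point → Point → Set
OnSeg P A B = Σ ℚ λ t → (0ℚ ℚ.≤ t) × (t ℚ.≤ 1ℚ)
  × (proj₁ P ≡ proj₁ A ℚ.+ t ℚ.* (proj₁ B ℚ.- proj₁ A))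
  × (proj₂ P ≡ proj₂ A ℚ.+ t ℚ.* (proj₂ B ℚ.- proj₂ A))

Planar : ∀ {n} → SignedGraph n → Set
Planar {n} G = Σ (Fin n → Point) λ pos →
    Injective _≡_ _≡_ pos
  × (∀ u v w → adj G u v ≡ true → OnSeg (pos w) (pos u) (pos v) → (w ≡ u ⊎ w ≡ v))
  × (∀ u v x y P → adj G u v ≡ true → adj G x y ≡ true
       → OnSeg P (pos u) (pos v) → OnSeg P (pos x) (pos y)
       → ((u ≡ x × v ≡ y) ⊎ (u ≡ y × v ≡ x))
         ⊎ (Σ (Fin n) λ z → (z ≡ u ⊎ z ≡ v) × (z ≡ x ⊎ z ≡ y) × (P ≡ pos z)))

{-# OPTIONS --safe #-}
module Submission where

-- The graph is built so that every balanced set S satisfies one linear inequality.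
-- A vertex placed in a negative triangle creates a K₄ all of whose triangles are negative,
-- so |S ∩ K₄| ≤ 2, and |S ∩ K₄| ≤ 1 when S misses the original triangle.  A gadget on an edge
-- uv with nine such K₄'s has the property that a balanced S containing both u and v misses
-- one of the nine triangles.  Glue a gadget onto each side of a triangle.  Counting the 27 K₄'s
-- twice and the three corners once, S receives at most 2·54 + 1 = 109: if some K₄ contains at
-- most one vertex of S the total is at most 2·53 + 3, and otherwise S contains at most one corner.
-- The full weight is 2·108 + 3 = 219, so p/q ≥ 219/109 for every balanced (p,q)-coloring.

open import Defs
open import Data.Nat as ℕ using (ℕ; zero; suc)
open import Data.Nat.DivMod using (_mod_)
open import Data.Nat.ListAction using (sum)
open import Data.Nat.ListAction.Properties using (sum-++)
import Data.Nat.Properties as ℕ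
open import Data.Nat.Tactic.RingSolver using (solve-∀)
open import Data.Bool using (Bool; true; false; not; _∧_; _∨_; T; if_then_else_)
import Data.Bool as Bool
open import Data.Bool.ListAction using (any; all; and)
open import Data.Bool.Properties using (∨-comm; T-≡; T-∨; T-∧)
open import Data.Empty using (⊥-elim)
open import Data.Fin using (Fin; toℕ)
import Data.Fin.Properties as Fin
open import Data.Fin.Subset using (Subset; ∣_∣)
open import Data.List using (List; []; _∷_; _++_; map; length; concatMap; upTo; allFin)
open import Data.List.Membership.Propositional using (_∈_)
open import Data.List.Membership.Propositional.Properties using (∈-allFin)
open import Data.List.Properties using (map-++; map-∘)
open import Data.List.Relation.Unary.All as All using (All; []; _∷_; all?)
import Data.List.Relation.Unary.All.Properties as All
open import Data.List.Relation.Unary.AllPairs using (allPairs?)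
import Data.List.Relation.Unary.Any as Any
import Data.List.Relation.Unary.Any.Properties as Any
open import Data.List.Relation.Unary.Unique.Propositional using (Unique)
open import Data.Product as Product using (Σ; _×_; _,_; proj₁; proj₂)
open import Data.Product.Properties using (≡-dec)
open import Data.Rational using (ℚ; 0ℚ; 1ℚ)
open import Data.Sum as Sum using (_⊎_; inj₁; inj₂)
open import Data.Unit using (tt)
open import Data.Vec as Vec using (Vec; []; _∷_)
open import Data.Vec.Properties using (lookup⇒[]=)
open import Algebra.Properties.CommutativeMonoid.Sum ℕ.+-0-commutativeMonoid using (∑-distrib-+; sum-replicate-zero) renaming (sum to ∑)
open import Function using (_∘_; Equivalence)
open import Relation.Binary using (tri<; tri≈; tri>)
open import Relation.Binary.PropositionalEquality
open import Relation.Nullary using (Dec; yes; no; ¬_; ¬?; contradiction; _×-dec_; _⊎-dec_; _→-dec_)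
open import Relation.Nullary.Decidable using (⌊_⌋; map′; from-yes; toWitness)

-- Decided through `toℕ`, so that the finite checks on 72 vertices come down to comparing natural
-- numbers.
_≟_ : ∀ {n} (a b : Fin n) → Dec (a ≡ b)
a ≟ b = map′ Fin.toℕ-injective (cong toℕ) (toℕ a ℕ.≟ toℕ b)

-- Straight-line drawings on the integer grid

module Segments where
  open import Data.Rational using (_+_; _*_; _-_; -_; _<_; _≤_; positive; nonNegative; ≢-nonZero; 1/_)
  open import Data.Rational.Properties
  open import Data.Rational.Solver using (module +-*-Solver)

  fromNat : ℕ → ℚ
  fromNat zero    = 0ℚ
  fromNat (suc m) = 1ℚ + fromNat m

  fromNat-+ : ∀ m n → fromNat (m ℕ.+ n) ≡ fromNat m + fromNat n
  fromNat-+ zero    n = sym (+-identityˡ _)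
  fromNat-+ (suc m) n = trans (cong (1ℚ +_) (fromNat-+ m n)) (sym (+-assoc 1ℚ (fromNat m) (fromNat n)))

  fromNat-* : ∀ m n → fromNat (m ℕ.* n) ≡ fromNat m * fromNat n
  fromNat-* zero    n = sym (*-zeroˡ (fromNat n))
  fromNat-* (suc m) n = begin
    fromNat (n ℕ.+ m ℕ.* n)                ≡⟨ fromNat-+ n (m ℕ.* n) ⟩
    fromNat n + fromNat (m ℕ.* n)          ≡⟨ cong₂ _+_ (sym (*-identityˡ (fromNat n))) (fromNat-* m n) ⟩
    1ℚ * fromNat n + fromNat m * fromNat n ≡⟨ *-distribʳ-+ (fromNat n) 1ℚ (fromNat m) ⟨
    (1ℚ + fromNat m) * fromNat n           ∎
    where open ≡-Reasoning

  fromNat-nonNeg : ∀ m → 0ℚ ≤ fromNat m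
  fromNat-nonNeg zero    = ≤-refl
  fromNat-nonNeg (suc m) = +-mono-≤ (nonNegative⁻¹ 1ℚ) (fromNat-nonNeg m)

  fromNat-mono-< : ∀ {m n} → m ℕ.< n → fromNat m < fromNat n
  fromNat-mono-< {m} m<n with k , refl ← ℕ.m≤n⇒∃[o]m+o≡n m<n = begin-strict
    fromNat m                      ≡⟨ +-identityˡ _ ⟨
    0ℚ + fromNat m                 <⟨ +-monoˡ-< (fromNat m) (positive⁻¹ 1ℚ) ⟩
    fromNat (suc m)                ≡⟨ +-identityʳ _ ⟨
    fromNat (suc m) + 0ℚ           ≤⟨ +-monoʳ-≤ (fromNat (suc m)) (fromNat-nonNeg k) ⟩
    fromNat (suc m) + fromNat k    ≡⟨ fromNat-+ (suc m) k ⟨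
    fromNat (suc m ℕ.+ k)          ∎
    where open ≤-Reasoning

  fromNat-injective : ∀ {m n} → fromNat m ≡ fromNat n → m ≡ n
  fromNat-injective {m} {n} eq with ℕ.<-cmp m n
  ... | tri< m<n _ _ = ⊥-elim (<-irrefl eq (fromNat-mono-< m<n))
  ... | tri≈ _ m≡n _ = m≡n
  ... | tri> _ _ n<m = ⊥-elim (<-irrefl (sym eq) (fromNat-mono-< n<m))

  -- Twice the signed area of the triangle: positive when the third point lies to the left of the
  -- directed line through the first two.
  area : Point → Point → Point → ℚ
  area (ax , ay) (bx , by) (cx , cy) = (bx - ax) * (cy - ay) - (by - ay) * (cx - ax)

  module _ where
    open +-*-Solver

    zero-offset : ∀ a p → (a + p) - a ≡ p
    zero-offset = solve 2 (λ a p → (a :+ p) :- a := p) refl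

    convex-offset : ∀ a c d t → (c + t * (d - c)) - a ≡ (1ℚ - t) * (c - a) + t * (d - a)
    convex-offset = solve 4 (λ a c d t →
      (c :+ t :* (d :- c)) :- a := (con 1ℚ :- t) :* (c :- a) :+ t :* (d :- a)) refl

    determinant-parallel : ∀ p q t → p * (t * q) - q * (t * p) ≡ 0ℚ
    determinant-parallel = solve 3 (λ p q t → p :* (t :* q) :- q :* (t :* p) := con 0ℚ) refl

    determinant-linear : ∀ p q k t a b c d →
      p * (k * a + t * b) - q * (k * c + t * d) ≡ k * (p * a - q * c) + t * (p * b - q * d)
    determinant-linear = solve 8 (λ p q k t a b c d →
      p :* (k :* a :+ t :* b) :- q :* (k :* c :+ t :* d) :=
      k :* (p :* a :- q :* c) :+ t :* (p :* b :- q :* d)) refl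

    determinant-zero : ∀ p q a b → p * (a - a) - q * (b - b) ≡ 0ℚ
    determinant-zero = solve 4 (λ p q a b → p :* (a :- a) :- q :* (b :- b) := con 0ℚ) refl

    reversed-segment : ∀ a b t → a + t * (b - a) ≡ b + (1ℚ - t) * (a - b)
    reversed-segment = solve 3 (λ a b t → a :+ t :* (b :- a) := b :+ (con 1ℚ :- t) :* (a :- b)) refl

    convex-at-0 : ∀ p q → (1ℚ - 0ℚ) * p + 0ℚ * q ≡ p
    convex-at-0 = solve 2 (λ p q → (con 1ℚ :- con 0ℚ) :* p :+ con 0ℚ :* q := p) refl

    segment-at-0 : ∀ a c → a + 0ℚ * (c - a) ≡ a
    segment-at-0 = solve 2 (λ a c → a :+ con 0ℚ :* (c :- a) := a) refl

    determinant-expansion : ∀ a b c d e f →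
      (c - a) * (f - b) - (d - b) * (e - a) ≡ (a * d + c * f + e * b) - (b * c + d * e + f * a)
    determinant-expansion = solve 6 (λ a b c d e f →
      (c :- a) :* (f :- b) :- (d :- b) :* (e :- a) :=
      (a :* d :+ c :* f :+ e :* b) :- (b :* c :+ d :* e :+ f :* a)) refl

  area-base : ∀ A B → area A B A ≡ 0ℚ
  area-base (ax , ay) (bx , by) = determinant-zero (bx - ax) (by - ay) ay ax

  area-on-segment : ∀ A B {P} → OnSeg P A B → area A B P ≡ 0ℚ
  area-on-segment (ax , ay) (bx , by) (t , _ , _ , refl , refl) = trans
    (cong₂ (λ p q → (bx - ax) * p - (by - ay) * q) (zero-offset ay _) (zero-offset ax _))
    (determinant-parallel (bx - ax) (by - ay) t)

  -- For fixed `A` and `B` the area is an affine function of the third point, so along `CD` it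
  -- interpolates between its end values.
  area-affine : ∀ A B C D {P} → ((t , _) : OnSeg P C D) →
                area A B P ≡ (1ℚ - t) * area A B C + t * area A B D
  area-affine (ax , ay) (bx , by) (cx , cy) (dx , dy) (t , _ , _ , refl , refl) = trans
    (cong₂ (λ p q → (bx - ax) * p - (by - ay) * q) (convex-offset ay cy dy t) (convex-offset ax cx dx t))
    (determinant-linear (bx - ax) (by - ay) (1ℚ - t) t (cy - ay) (dy - ay) (cx - ax) (dx - ax))

  0≤1-t : ∀ {t} → t ≤ 1ℚ → 0ℚ ≤ 1ℚ - t
  0≤1-t {t} t≤1 = subst (_≤ 1ℚ - t) (+-inverseʳ 1ℚ) (+-monoʳ-≤ 1ℚ (neg-antimono-≤ t≤1))

  OnSeg-sym : ∀ A B {P} → OnSeg P A B → OnSeg P B A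
  OnSeg-sym (ax , ay) (bx , by) (t , 0≤t , t≤1 , refl , refl) =
    1ℚ - t , 0≤1-t t≤1
    , subst (1ℚ - t ≤_) (+-identityʳ 1ℚ) (+-monoʳ-≤ 1ℚ (neg-antimono-≤ 0≤t))
    , reversed-segment ax bx t , reversed-segment ay by t

  convex-positive : ∀ {p q t} → 0ℚ ≤ t → t ≤ 1ℚ → 0ℚ < p → 0ℚ < q → 0ℚ < (1ℚ - t) * p + t * q
  -- Strictness comes from the second term when `t` is positive and from the first when `t` is zero.
  convex-positive {p} {q} {t} 0≤t t≤1 0<p 0<q with 0ℚ <? t
  ... | yes 0<t = +-mono-≤-<
    (nonNegative⁻¹ ((1ℚ - t) * p) {{nonNeg*nonNeg⇒nonNeg (1ℚ - t) {{nonNegative (0≤1-t t≤1)}} p {{nonNegative (<⇒≤ 0<p)}}}})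
    (positive⁻¹ (t * q) {{pos*pos⇒pos t {{positive 0<t}} q {{positive 0<q}}}})
  ... | no  0≮t with refl ← ≤-antisym 0≤t (≮⇒≥ 0≮t) =
    subst (0ℚ <_) (sym (convex-at-0 p q)) 0<p

  -- The area relative to `AB` vanishes on `AB` but, by interpolation, stays positive on `CD`.
  disjoint-segments : ∀ A B C D {P} → 0ℚ < area A B C → 0ℚ < area A B D →
                      OnSeg P A B → ¬ OnSeg P C D
  disjoint-segments A B C D 0<C 0<D onAB onCD@(t , 0≤t , t≤1 , _) =
    <-irrefl (trans (sym (area-on-segment A B onAB)) (area-affine A B C D onCD)) (convex-positive 0≤t t≤1 0<C 0<D)

  *-zero-divisor : ∀ {p q} → p * q ≡ 0ℚ → q ≢ 0ℚ → p ≡ 0ℚ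
  *-zero-divisor {p} {q} pq≡0 q≢0 = begin
    p                ≡⟨ *-identityʳ p ⟨
    p * 1ℚ           ≡⟨ cong (p *_) (*-inverseʳ q) ⟨
    p * (q * 1/ q)   ≡⟨ *-assoc p q (1/ q) ⟨
    p * q * 1/ q     ≡⟨ cong (_* 1/ q) pq≡0 ⟩
    0ℚ * 1/ q        ≡⟨ *-zeroˡ (1/ q) ⟩
    0ℚ               ∎
    where
    instance _ = ≢-nonZero q≢0
    open ≡-Reasoning

  -- Along `AC` the area relative to `AB` is `t * area A B C`. It vanishes at a point of `AB`, which
  -- forces `t` to be zero.
  common-endpoint : ∀ A B C {P} → area A B C ≢ 0ℚ → OnSeg P A B → OnSeg P A C → P ≡ A
  common-endpoint A@(ax , ay) B C@(cx , cy) {P} area≢0 onAB onAC@(t , _ , _ , x-eq , y-eq) =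
    cong₂ _,_ (trans x-eq (at-start ax cx)) (trans y-eq (at-start ay cy))
    where
    t*area≡0 : t * area A B C ≡ 0ℚ
    t*area≡0 = begin
      t * area A B C                                 ≡⟨ +-identityˡ _ ⟨
      0ℚ + t * area A B C                            ≡⟨ cong (_+ t * area A B C) (*-zeroʳ (1ℚ - t)) ⟨
      (1ℚ - t) * 0ℚ + t * area A B C                 ≡⟨ cong (λ r → (1ℚ - t) * r + t * area A B C) (area-base A B) ⟨
      (1ℚ - t) * area A B A + t * area A B C         ≡⟨ area-affine A B A C {P} onAC ⟨
      area A B P                                     ≡⟨ area-on-segment A B {P} onAB ⟩
      0ℚ                                             ∎
      where open ≡-Reasoning
    at-start : ∀ a c → a + t * (c - a) ≡ a
    at-start a c = trans (cong (λ r → a + r * (c - a)) (*-zero-divisor {t} t*area≡0 area≢0)) (segment-at-0 a c)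

  GridPoint : Set
  GridPoint = ℕ × ℕ

  toPoint : GridPoint → Point
  toPoint (a , b) = fromNat a , fromNat b

  -- The two halves of the determinant expansion of twice the signed area, so that the
  -- orientation of a triangle is a comparison of natural numbers.
  area⁺ area⁻ : GridPoint → GridPoint → GridPoint → ℕ
  area⁺ (a , b) (c , d) (e , f) = a ℕ.* d ℕ.+ c ℕ.* f ℕ.+ e ℕ.* b
  area⁻ (a , b) (c , d) (e , f) = b ℕ.* c ℕ.+ d ℕ.* e ℕ.+ f ℕ.* a

  fromNat-sum₃ : ∀ a b c d e f → fromNat (a ℕ.* b ℕ.+ c ℕ.* d ℕ.+ e ℕ.* f) ≡
    fromNat a * fromNat b + fromNat c * fromNat d + fromNat e * fromNat f
  fromNat-sum₃ a b c d e f = trans (fromNat-+ (a ℕ.* b ℕ.+ c ℕ.* d) (e ℕ.* f))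
    (cong₂ _+_ (trans (fromNat-+ (a ℕ.* b) (c ℕ.* d)) (cong₂ _+_ (fromNat-* a b) (fromNat-* c d))) (fromNat-* e f))

  area-toPoint : ∀ A B C → area (toPoint A) (toPoint B) (toPoint C) ≡ fromNat (area⁺ A B C) - fromNat (area⁻ A B C)
  area-toPoint (a , b) (c , d) (e , f) = trans
    (determinant-expansion (fromNat a) (fromNat b) (fromNat c) (fromNat d) (fromNat e) (fromNat f))
    (sym (cong₂ _-_ (fromNat-sum₃ a d c f e b) (fromNat-sum₃ b c d e f a)))

  Left Collinear : GridPoint → GridPoint → GridPoint → Set
  Left      A B C = area⁻ A B C ℕ.< area⁺ A B C
  Collinear A B C = area⁻ A B C ≡ area⁺ A B C

  Collinear-swap : ∀ A B C → Collinear A B C → Collinear B A C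
  Collinear-swap (a , b) (c , d) (e , f) eq = trans (lhs a b c d e f) (trans (sym eq) (rhs a b c d e f))
    where
    lhs : ∀ a b c d e f → d ℕ.* a ℕ.+ b ℕ.* e ℕ.+ f ℕ.* c ≡ a ℕ.* d ℕ.+ c ℕ.* f ℕ.+ e ℕ.* b
    lhs = solve-∀
    rhs : ∀ a b c d e f → b ℕ.* c ℕ.+ d ℕ.* e ℕ.+ f ℕ.* a ≡ c ℕ.* b ℕ.+ a ℕ.* f ℕ.+ e ℕ.* d
    rhs = solve-∀

  Left⇒area>0 : ∀ {A B C} → Left A B C → 0ℚ < area (toPoint A) (toPoint B) (toPoint C)
  Left⇒area>0 {A} {B} {C} left = subst₂ _<_ (+-inverseʳ (fromNat (area⁻ A B C))) (sym (area-toPoint A B C))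
    (+-monoˡ-< (- fromNat (area⁻ A B C)) (fromNat-mono-< left))

  area≡0⇒Collinear : ∀ A B C → area (toPoint A) (toPoint B) (toPoint C) ≡ 0ℚ → Collinear A B C
  area≡0⇒Collinear A B C eq = fromNat-injective (sym (p-q≡0⇒p≡q (trans (sym (area-toPoint A B C)) eq)))
    where
    p-q≡0⇒p≡q : ∀ {p q} → p - q ≡ 0ℚ → p ≡ q
    p-q≡0⇒p≡q {p} {q} e = begin
      p               ≡⟨ +-identityʳ p ⟨
      p + 0ℚ          ≡⟨ cong (p +_) (+-inverseˡ q) ⟨
      p + (- q + q)   ≡⟨ +-assoc p (- q) q ⟨
      (p - q) + q     ≡⟨ cong (_+ q) e ⟩
      0ℚ + q          ≡⟨ +-identityˡ q ⟩
      q               ∎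
      where open ≡-Reasoning

  toPoint-injective : ∀ {A B} → toPoint A ≡ toPoint B → A ≡ B
  toPoint-injective eq = cong₂ _,_ (fromNat-injective (cong proj₁ eq)) (fromNat-injective (cong proj₂ eq))

open Segments
open import Data.Nat using (_+_; _*_; _%_; _≤_; _<_; z≤n; s≤s; _≤?_)

-- Planarity from finitely many orientation tests

SameSide : GridPoint → GridPoint → GridPoint → GridPoint → Set
SameSide A B C D = (Left A B C × Left A B D) ⊎ (Left B A C × Left B A D)

sameSide? : ∀ A B C D → Dec (SameSide A B C D)
sameSide? A B C D = (left? A B C ×-dec left? A B D) ⊎-dec (left? B A C ×-dec left? B A D)
  where
  left? : ∀ A B C → Dec (Left A B C)
  left? A B C = area⁻ A B C ℕ.<? area⁺ A B C

SameSide⇒disjoint : ∀ A B C D {P} → SameSide A B C D →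
                    OnSeg P (toPoint A) (toPoint B) → ¬ OnSeg P (toPoint C) (toPoint D)
SameSide⇒disjoint A B C D (inj₁ (c , d)) onAB onCD = disjoint-segments (toPoint A) (toPoint B) (toPoint C) (toPoint D)
  (Left⇒area>0 {A} {B} {C} c) (Left⇒area>0 {A} {B} {D} d) onAB onCD
SameSide⇒disjoint A B C D (inj₂ (c , d)) onAB onCD = disjoint-segments (toPoint B) (toPoint A) (toPoint C) (toPoint D)
  (Left⇒area>0 {B} {A} {C} c) (Left⇒area>0 {B} {A} {D} d) (OnSeg-sym (toPoint A) (toPoint B) onAB) onCD

module StraightLineDrawing {n} (es : List (Fin n × Fin n)) (pos : Fin n → GridPoint) where

  Vertex : Set
  Vertex = Fin n × GridPoint

  locate : Fin n → Vertex
  locate a = a , pos a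

  vertices : List Vertex
  vertices = map locate (allFin n)

  segments : List (Vertex × Vertex)
  segments = map (λ (a , b) → locate a , locate b) es

  Distinct : Vertex → Vertex → Set
  Distinct (a , A) (b , B) = A ≡ B → a ≡ b

  -- The condition concerns the whole line through an edge, not just the segment, so it also keeps
  -- two edges with a common end from being collinear.
  Avoids : Vertex × Vertex → Vertex → Set
  Avoids ((a , A) , (b , B)) (w , W) = ¬ Collinear A B W ⊎ (w ≡ a ⊎ w ≡ b)

  -- Of two disjoint segments in general position, one lies strictly on one side of the line through
  -- the other, so testing both lines suffices. Pairs with a common end are exempt: distinct edges
  -- of this kind are handled by `Avoids`.
  Apart : Vertex × Vertex → Vertex × Vertex → Set
  Apart ((a , A) , (b , B)) ((c , C) , (d , D)) =
    (SameSide A B C D ⊎ SameSide C D A B) ⊎ ((a ≡ c ⊎ a ≡ d) ⊎ (b ≡ c ⊎ b ≡ d))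

  InGeneralPosition : Set
  InGeneralPosition = All (λ v → All (Distinct v) vertices) vertices
                    × All (λ e → All (Avoids e) vertices) segments
                    × All (λ e → All (Apart e) segments) segments

  inGeneralPosition? : Dec InGeneralPosition
  inGeneralPosition? =
          all? (λ v → all? (distinct? v) vertices) vertices
    ×-dec all? (λ e → all? (avoids? e) vertices) segments
    ×-dec all? (λ e → all? (apart? e) segments) segments
    where
    distinct? : ∀ v w → Dec (Distinct v w)
    distinct? (a , A) (b , B) = ≡-dec ℕ._≟_ ℕ._≟_ A B →-dec a ≟ b
    avoids? : ∀ e w → Dec (Avoids e w)
    avoids? ((a , A) , (b , B)) (w , W) = ¬? (area⁻ A B W ℕ.≟ area⁺ A B W) ⊎-dec (w ≟ a ⊎-dec w ≟ b)
    apart? : ∀ e f → Dec (Apart e f)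
    apart? ((a , A) , (b , B)) ((c , C) , (d , D)) =
      (sameSide? A B C D ⊎-dec sameSide? C D A B) ⊎-dec ((a ≟ c ⊎-dec a ≟ d) ⊎-dec (b ≟ c ⊎-dec b ≟ d))

  module _ (G : SignedGraph n) (adj⇒∈ : ∀ a b → adj G a b ≡ true → (a , b) ∈ es ⊎ (b , a) ∈ es)
           (general : InGeneralPosition) where

    distinct : All (λ v → All (Distinct v) vertices) vertices
    distinct = proj₁ general

    avoids : All (λ e → All (Avoids e) vertices) segments
    avoids = proj₁ (proj₂ general)

    apart : All (λ e → All (Apart e) segments) segments
    apart = proj₂ (proj₂ general)

    point : Fin n → Point
    point a = toPoint (pos a)

    Noncollinear : ∀ a b w → adj G a b ≡ true → w ≢ a → w ≢ b → ¬ Collinear (pos a) (pos b) (pos w)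
    Noncollinear a b w ab w≢a w≢b with adj⇒∈ a b ab
    ... | inj₁ ab∈ with All.lookup (All.map⁻ (All.lookup (All.map⁻ avoids) ab∈)) (∈-allFin w)
    ...   | inj₁ free       = free
    ...   | inj₂ (inj₁ w≡a) = ⊥-elim (w≢a w≡a)
    ...   | inj₂ (inj₂ w≡b) = ⊥-elim (w≢b w≡b)
    Noncollinear a b w ab w≢a w≢b | inj₂ ba∈ with All.lookup (All.map⁻ (All.lookup (All.map⁻ avoids) ba∈)) (∈-allFin w)
    ...   | inj₁ free       = λ abw → free (Collinear-swap (pos a) (pos b) (pos w) abw)
    ...   | inj₂ (inj₁ w≡b) = ⊥-elim (w≢b w≡b)
    ...   | inj₂ (inj₂ w≡a) = ⊥-elim (w≢a w≡a)

    vertex-off-edge : ∀ a b w → adj G a b ≡ true → OnSeg (point w) (point a) (point b) → w ≡ a ⊎ w ≡ b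
    vertex-off-edge a b w ab on with w ≟ a | w ≟ b
    ... | yes w≡a | _       = inj₁ w≡a
    ... | no  _   | yes w≡b = inj₂ w≡b
    ... | no  w≢a | no  w≢b = ⊥-elim (Noncollinear a b w ab w≢a w≢b
      (area≡0⇒Collinear (pos a) (pos b) (pos w) (area-on-segment (point a) (point b) on)))

    meet-at-endpoint : ∀ a b c {P} → adj G a b ≡ true → adj G a c ≡ true → c ≢ b →
                       OnSeg P (point a) (point b) → OnSeg P (point a) (point c) → P ≡ point a
    meet-at-endpoint a b c ab ac c≢b = common-endpoint (point a) (point b) (point c)
      (λ eq → Noncollinear a b c ab c≢a c≢b (area≡0⇒Collinear (pos a) (pos b) (pos c) eq))
      where
      c≢a : c ≢ a
      c≢a refl with () ← trans (sym ac) (adj-irr G a)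

    segments-disjoint : ∀ a b c d {P} → (a , b) ∈ es → (c , d) ∈ es → a ≢ c → a ≢ d → b ≢ c → b ≢ d →
                        OnSeg P (point a) (point b) → ¬ OnSeg P (point c) (point d)
    segments-disjoint a b c d ab∈ cd∈ a≢c a≢d b≢c b≢d onAB onCD
      with All.lookup (All.map⁻ (All.lookup (All.map⁻ apart) ab∈)) cd∈
    ... | inj₁ (inj₁ same)       = SameSide⇒disjoint (pos a) (pos b) (pos c) (pos d) same onAB onCD
    ... | inj₁ (inj₂ same)       = SameSide⇒disjoint (pos c) (pos d) (pos a) (pos b) same onCD onAB
    ... | inj₂ (inj₁ (inj₁ a≡c)) = a≢c a≡c
    ... | inj₂ (inj₁ (inj₂ a≡d)) = a≢d a≡d
    ... | inj₂ (inj₂ (inj₁ b≡c)) = b≢c b≡c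
    ... | inj₂ (inj₂ (inj₂ b≡d)) = b≢d b≡d

    edges-disjoint : ∀ a b c d {P} → adj G a b ≡ true → adj G c d ≡ true →
                     a ≢ c → a ≢ d → b ≢ c → b ≢ d →
                     OnSeg P (point a) (point b) → ¬ OnSeg P (point c) (point d)
    edges-disjoint a b c d ab cd a≢c a≢d b≢c b≢d onAB onCD with adj⇒∈ a b ab | adj⇒∈ c d cd
    ... | inj₁ ab∈ | inj₁ cd∈ = segments-disjoint a b c d ab∈ cd∈ a≢c a≢d b≢c b≢d onAB onCD
    ... | inj₁ ab∈ | inj₂ dc∈ = segments-disjoint a b d c ab∈ dc∈ a≢d a≢c b≢d b≢c onAB
                                  (OnSeg-sym (point c) (point d) onCD)
    ... | inj₂ ba∈ | inj₁ cd∈ = segments-disjoint b a c d ba∈ cd∈ b≢c b≢d a≢c a≢d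
                                  (OnSeg-sym (point a) (point b) onAB) onCD
    ... | inj₂ ba∈ | inj₂ dc∈ = segments-disjoint b a d c ba∈ dc∈ b≢d b≢c a≢d a≢c
                                  (OnSeg-sym (point a) (point b) onAB) (OnSeg-sym (point c) (point d) onCD)

    planar : Planar G
    planar = point , injective , vertex-off-edge , crossing
      where
      injective : ∀ {a b} → point a ≡ point b → a ≡ b
      injective {a} {b} eq =
        All.lookup (All.map⁻ (All.lookup (All.map⁻ distinct) (∈-allFin a))) (∈-allFin b) (toPoint-injective eq)

      crossing : ∀ a b c d P → adj G a b ≡ true → adj G c d ≡ true →
                 OnSeg P (point a) (point b) → OnSeg P (point c) (point d) →
                 ((a ≡ c × b ≡ d) ⊎ (a ≡ d × b ≡ c))
                 ⊎ (Σ (Fin n) λ w → (w ≡ a ⊎ w ≡ b) × (w ≡ c ⊎ w ≡ d) × (P ≡ point w))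
      crossing a b c d P ab cd onAB onCD with a ≟ c | a ≟ d | b ≟ c | b ≟ d
      -- Two common ends give the same edge, a single common end is the only possible meeting point,
      -- and without common ends the segments are disjoint.
      ... | yes refl | _        | _        | yes refl = inj₁ (inj₁ (refl , refl))
      ... | _        | yes refl | yes refl | _        = inj₁ (inj₂ (refl , refl))
      ... | yes refl | _        | _        | no  b≢d  = inj₂ (a , inj₁ refl , inj₁ refl ,
        meet-at-endpoint a b d ab cd (≢-sym b≢d) onAB onCD)
      ... | no  _    | yes refl | no  b≢c  | _        = inj₂ (a , inj₁ refl , inj₂ refl ,
        meet-at-endpoint a b c ab (trans (adj-sym G a c) cd) (≢-sym b≢c) onAB (OnSeg-sym (point c) (point a) onCD))
      ... | no  a≢c  | no  a≢d  | yes refl | _        = inj₂ (b , inj₂ refl , inj₁ refl ,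
        meet-at-endpoint b a d (trans (adj-sym G b a) ab) cd (≢-sym a≢d) (OnSeg-sym (point a) (point b) onAB) onCD)
      ... | no  a≢c  | no  a≢d  | no  b≢c  | yes refl = inj₂ (b , inj₂ refl , inj₂ refl ,
        meet-at-endpoint b a c (trans (adj-sym G b a) ab) (trans (adj-sym G b c) cd) (≢-sym a≢c)
          (OnSeg-sym (point a) (point b) onAB) (OnSeg-sym (point c) (point b) onCD))
      ... | no  a≢c  | no  a≢d  | no  b≢c  | no  b≢d  = ⊥-elim (edges-disjoint a b c d ab cd a≢c a≢d b≢c b≢d onAB onCD)

-- Balanced sets and negative cycles

NegativeCycle : ∀ {n} → SignedGraph n → List (Fin n) → Set
NegativeCycle G vs =
  (3 ≤ length vs) × Unique vs × All (λ e → adj G (proj₁ e) (proj₂ e) ≡ true) (cycEdges vs)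
  × negCount G vs % 2 ≡ 1

negativeCycle? : ∀ {n} (G : SignedGraph n) vs → Dec (NegativeCycle G vs)
negativeCycle? G vs =
  3 ≤? length vs ×-dec allPairs? (λ a b → ¬? (a ≟ b)) vs
  ×-dec all? (λ e → adj G (proj₁ e) (proj₂ e) Bool.≟ true) (cycEdges vs)
  ×-dec (negCount G vs % 2) ℕ.≟ 1

Quadruple : Set → Set
Quadruple A = A × A × A × A

members base : ∀ {A : Set} → Quadruple A → List A
members (d , a , b , c) = d ∷ a ∷ b ∷ c ∷ []
base    (d , a , b , c) = a ∷ b ∷ c ∷ []

triangles : ∀ {A : Set} → Quadruple A → List (List A)
triangles (d , a , b , c) =
  (d ∷ a ∷ b ∷ []) ∷ (d ∷ a ∷ c ∷ []) ∷ (d ∷ b ∷ c ∷ []) ∷ (a ∷ b ∷ c ∷ []) ∷ []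

-- Counting with multiplicity and the fractional lower bound

indicator : Bool → ℕ
indicator b = if b then 1 else 0

count : ∀ {A : Set} → (A → Bool) → List A → ℕ
count χ vs = sum (map (indicator ∘ χ) vs)

count-++ : ∀ {A : Set} (χ : A → Bool) vs ws → count χ (vs ++ ws) ≡ count χ vs + count χ ws
count-++ χ vs ws = trans (cong sum (map-++ (indicator ∘ χ) vs ws)) (sum-++ (map (indicator ∘ χ) vs) _)

count≤length : ∀ {A : Set} (χ : A → Bool) vs → count χ vs ≤ length vs
count≤length χ []       = z≤n
count≤length χ (w ∷ vs) with χ w
... | true  = s≤s (count≤length χ vs)
... | false = ℕ.m≤n⇒m≤1+n (count≤length χ vs)

∑-indicator : ∀ {p} (S : Subset p) → ∑ (indicator ∘ Vec.lookup S) ≡ ∣ S ∣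
∑-indicator []          = refl
∑-indicator (true  ∷ S) = cong suc (∑-indicator S)
∑-indicator (false ∷ S) = ∑-indicator S

∑-count : ∀ {n p q} (f : Fin n → Subset p) → (∀ w → ∣ f w ∣ ≡ q) →
          ∀ vs → ∑ (λ c → count (λ w → Vec.lookup (f w) c) vs) ≡ length vs * q
∑-count {p = p} f size []       = sum-replicate-zero p
∑-count         f size (w ∷ vs) = trans (∑-distrib-+ (indicator ∘ Vec.lookup (f w)) _)
  (cong₂ _+_ (trans (∑-indicator (f w)) (size w)) (∑-count f size vs))

∑-bounded : ∀ {p b} (g : Fin p → ℕ) → (∀ c → g c ≤ b) → ∑ g ≤ p * b
∑-bounded {zero}  g g≤b = z≤n
∑-bounded {suc p} g g≤b = ℕ.+-mono-≤ (g≤b Fin.zero) (∑-bounded (g ∘ Fin.suc) (g≤b ∘ Fin.suc))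

-- Weak linear programming duality, with multiplicities in `vs` as weights: each colour class has
-- weight at most `b` and each vertex lies in `q` classes, so double counting gives
-- `length vs * q ≤ p * b`.
fractional-bound : ∀ {n b} (G : SignedGraph n) (vs : List (Fin n)) →
  (∀ χ → Balanced G (T ∘ χ) → count χ vs ≤ b) → FracBalChromGe G (length vs) b
fractional-bound G vs bound p q _ _ (f , size , balanced) =
  subst (_≤ p * _) (∑-count f size vs) (∑-bounded _ λ c → bound _ (λ ws (long , unique , inside , closed) →
    balanced c ws (long , unique , All.map (λ {w} → lookup⇒[]= c (f w) ∘ Equivalence.to T-≡) inside , closed)))

avoids-negative : ∀ {n} (G : SignedGraph n) χ → Balanced G (T ∘ χ) →
                  ∀ {vs} → NegativeCycle G vs → T (not (all χ vs))
avoids-negative G χ balanced {vs} (long , unique , closed , odd) with all χ vs in eq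
... | false = tt
... | true  = contradiction (trans (sym odd) (balanced vs (long , unique , All.all⁺ χ vs (subst T (sym eq) tt) , closed))) λ ()

-- Boolean form: once the values of `χ` are split, a contradictory hypothesis becomes the empty type
-- and the case needs no clause.
Free Hit : ∀ {A : Set} → (A → Bool) → List A → Set
Free χ vs = T (not (all χ vs))
Hit  χ vs = T (any χ vs)

Free-map : ∀ {A B : Set} (χ : B → Bool) (g : A → B) vs → Free χ (map g vs) → Free (χ ∘ g) vs
Free-map χ g vs = subst (T ∘ not ∘ and) (sym (map-∘ vs))

count-map : ∀ {A B : Set} (χ : B → Bool) (g : A → B) vs → count χ (map g vs) ≡ count (χ ∘ g) vs
count-map χ g vs = cong sum (sym (map-∘ vs))

count-concatMap : ∀ {A B : Set} (χ : B → Bool) (g : A → List B) xs →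
                  count χ (concatMap g xs) ≡ sum (map (count χ ∘ g) xs)
count-concatMap χ g []       = refl
count-concatMap χ g (a ∷ xs) = trans (count-++ χ (g a) (concatMap g xs)) (cong (count χ (g a) +_) (count-concatMap χ g xs))

Tight : ∀ {A : Set} → (A → ℕ) → ℕ → (A → Set) → A → Set
Tight f b P a = (f a ≤ b × P a) ⊎ f a < b

-- One strict summand makes the whole sum strict, so the total can reach its bound only if `P` holds
-- throughout.
sum-tight : ∀ {A : Set} {f : A → ℕ} {b P xs} → All (Tight f b P) xs →
            Tight (sum ∘ map f) (length xs * b) (All P) xs
sum-tight []                     = inj₁ (z≤n , [])
sum-tight (inj₁ (fa≤b , pa) ∷ ps) with sum-tight ps
... | inj₁ (le , all)            = inj₁ (ℕ.+-mono-≤ fa≤b le , pa ∷ all)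
... | inj₂ lt                    = inj₂ (ℕ.+-mono-≤-< fa≤b lt)
sum-tight (inj₂ fa<b ∷ ps)        with sum-tight ps
... | inj₁ (le , _)              = inj₂ (ℕ.+-mono-<-≤ fa<b le)
... | inj₂ lt                    = inj₂ (ℕ.+-mono-< fa<b lt)

-- Three chosen members would span a negative triangle, so those cases are absurd. If the base is
-- missed, at most `d` remains, which gives the strict alternative.
K₄-tight : ∀ {A : Set} (χ : A → Bool) k → All (Free χ) (triangles k) →
           Tight (count χ ∘ members) 2 (Hit χ ∘ base) k
K₄-tight χ (d , a , b , c) (dab ∷ dac ∷ dbc ∷ abc ∷ []) with χ d | χ a | χ b | χ c
... | true  | false | false | false = inj₂ (s≤s (s≤s z≤n))
... | false | false | false | false = inj₂ (s≤s z≤n)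
... | true  | true  | false | false = inj₁ (s≤s (s≤s z≤n) , tt)
... | true  | false | true  | false = inj₁ (s≤s (s≤s z≤n) , tt)
... | true  | false | false | true  = inj₁ (s≤s (s≤s z≤n) , tt)
... | false | true  | true  | false = inj₁ (s≤s (s≤s z≤n) , tt)
... | false | true  | false | true  = inj₁ (s≤s (s≤s z≤n) , tt)
... | false | false | true  | true  = inj₁ (s≤s (s≤s z≤n) , tt)
... | false | true  | false | false = inj₁ (s≤s z≤n , tt)
... | false | false | true  | false = inj₁ (s≤s z≤n , tt)
... | false | false | false | true  = inj₁ (s≤s z≤n , tt)

-- The graph

occurs : ∀ {n} → List (Fin n × Fin n) → Fin n → Fin n → Bool
occurs es u v = any (λ (a , b) → ⌊ a ≟ u ⌋ ∧ ⌊ b ≟ v ⌋) es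

joins : ∀ {n} → List (Fin n × Fin n) → Fin n → Fin n → Bool
joins es u v = occurs es u v ∨ occurs es v u

joins⇒∈ : ∀ {n} (es : List (Fin n × Fin n)) a b → joins es a b ≡ true → (a , b) ∈ es ⊎ (b , a) ∈ es
joins⇒∈ es a b eq = Sum.map (occurs⇒∈ a b) (occurs⇒∈ b a) (Equivalence.to T-∨ (Equivalence.from T-≡ eq))
  where
  occurs⇒∈ : ∀ a b → T (occurs es a b) → (a , b) ∈ es
  occurs⇒∈ a b occ = Any.map (λ {(c , d)} → sym ∘ match c d) (Any.any⁻ _ es occ)
    where
    match : ∀ c d → T (⌊ c ≟ a ⌋ ∧ ⌊ d ≟ b ⌋) → (c , d) ≡ (a , b)
    match c d eqs with c≡a , d≡b ← Equivalence.to (T-∧ {⌊ c ≟ a ⌋}) eqs =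
      cong₂ _,_ (toWitness c≡a) (toWitness d≡b)

-- The gadget.  Vertices 0-9 span a triangulation dual to Tutte's fragment, the cubic plane graph
-- in which a fixed edge (here dual to uv) lies on every Hamiltonian path between the outer ends.
pattern u = 0
pattern v = 1
pattern x = 2
pattern x′ = 3
pattern y = 4
pattern y′ = 5
pattern z = 6
pattern z′ = 7
pattern s = 8
pattern t = 9

-- In (a , b , c , p , q , r) the octahedron has outer face abc, with p, q, r opposite to a, b, c.
octahedra : List (ℕ × ℕ × ℕ × ℕ × ℕ × ℕ)
octahedra = (x , s , t , 10 , 11 , 12) ∷ (y , y′ , t , 13 , 14 , 15) ∷ []

-- In (d , a , b , c) the vertex d lies inside the negative face abc, and dc is its negative edge.
plants : List (Quadruple ℕ)
plants =
    (16 , x  , y  , z) ∷ (17 , y′ , z′ , x′) ∷ (18 , x′ , t , s)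
  ∷ (19 , s  , 10 , t) ∷ (20 , t , 11 , x) ∷ (21 , x , 12 , s)
  ∷ (22 , y′ , 13 , t) ∷ (23 , t , 14 , y) ∷ (24 , y , 15 , y′) ∷ []

-- In each planted face only the side `ab` is negative, so positive edges `da`, `db` and a negative
-- edge `dc` make all four triangles negative. In an octahedron the sides of `abc` are positive, and
-- the signs make the faces `bcp`, `caq`, `abr` and the triangle `pqr` negative.
positive negative : List (ℕ × ℕ)
positive =
     (u , y′) ∷ (u , z) ∷ (u , z′) ∷ (v , x) ∷ (v , x′) ∷ (v , z) ∷ (v , z′)
   ∷ (x , z) ∷ (x , s) ∷ (x , t) ∷ (x′ , y′) ∷ (x′ , s) ∷ (y , y′) ∷ (y , z)
   ∷ (x′ , z′) ∷ (y , t) ∷ (y′ , t) ∷ (s , t) ∷ []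
  ++ concatMap (λ (a , b , c , p , q , r) → (p , c) ∷ (q , a) ∷ (r , b) ∷ []) octahedra
  ++ concatMap (λ (d , a , b , c) → (d , a) ∷ (d , b) ∷ []) plants
negative =
     (u , v) ∷ (u , y) ∷ (v , s) ∷ (x , y) ∷ (x′ , t) ∷ (y′ , z′) ∷ []
  ++ concatMap (λ (a , b , c , p , q , r) →
       (p , b) ∷ (q , c) ∷ (r , a) ∷ (p , q) ∷ (q , r) ∷ (p , r) ∷ []) octahedra
  ++ map (λ (d , a , b , c) → (d , c)) plants

-- The i-th gadget is attached to the side i, i+1 of the central triangle 0, 1, 2.
embed : ℕ → ℕ → Fin 72
embed i zero          = i mod 72
embed i (suc zero)    = (suc i % 3) mod 72
embed i (suc (suc k)) = (3 + 23 * i + k) mod 72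

copies : List (ℕ × ℕ) → List (Fin 72 × Fin 72)
copies es = concatMap (λ i → map (λ (a , b) → embed i a , embed i b) es) (upTo 3)

edges : List (Fin 72 × Fin 72)
edges = copies (positive ++ negative)

-- The 72 vertices are the three corners and, for each of the three gadgets, its 23 vertices
-- numbered 2 to 24.
G : SignedGraph 72
G = record
  { adj     = joins edges
  ; neg     = joins (copies negative)
  ; adj-sym = λ a b → ∨-comm (occurs edges a b) _
  ; adj-irr = from-yes (Fin.all? λ a → joins edges a a Bool.≟ false)
  ; neg-sym = λ a b → ∨-comm (occurs (copies negative) a b) _
  }

-- A weighted Tutte embedding of the gadget, rounded to integers.
positions : Vec GridPoint 72
positions =
    (256 , 199) ∷ (2 , 244) ∷ (87 , 0) ∷ (111 , 191) ∷ (133 , 212) ∷ (162 , 189)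
  ∷ (196 , 200) ∷ (117 , 151) ∷ (164 , 209) ∷ (74 , 218) ∷ (130 , 205) ∷ (102 , 208)
  ∷ (111 , 201) ∷ (100 , 207) ∷ (163 , 199) ∷ (155 , 197) ∷ (170 , 196) ∷ (122 , 164)
  ∷ (167 , 206) ∷ (114 , 212) ∷ (99 , 210) ∷ (115 , 199) ∷ (94 , 205) ∷ (162 , 201)
  ∷ (149 , 197) ∷ (176 , 194) ∷ (78 , 119) ∷ (48 , 132) ∷ (52 , 171) ∷ (28 , 193)
  ∷ (109 , 146) ∷ (33 , 164) ∷ (73 , 78) ∷ (57 , 131) ∷ (70 , 105) ∷ (69 , 118)
  ∷ (72 , 105) ∷ (45 , 165) ∷ (53 , 157) ∷ (44 , 171) ∷ (99 , 147) ∷ (37 , 165)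
  ∷ (58 , 114) ∷ (68 , 103) ∷ (69 , 124) ∷ (75 , 102) ∷ (44 , 164) ∷ (54 , 154)
  ∷ (42 , 179) ∷ (157 , 132) ∷ (162 , 101) ∷ (123 , 81) ∷ (118 , 51) ∷ (116 , 146)
  ∷ (143 , 76) ∷ (196 , 149) ∷ (154 , 108) ∷ (170 , 131) ∷ (162 , 126) ∷ (172 , 134)
  ∷ (135 , 81) ∷ (136 , 87) ∷ (127 , 77) ∷ (122 , 134) ∷ (138 , 73) ∷ (169 , 119)
  ∷ (176 , 130) ∷ (158 , 121) ∷ (173 , 137) ∷ (135 , 80) ∷ (138 , 93) ∷ (124 , 70) ∷ []

abstract
  positions-general : StraightLineDrawing.InGeneralPosition edges (Vec.lookup positions)
  positions-general = from-yes (StraightLineDrawing.inGeneralPosition? edges (Vec.lookup positions))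

G-planar : Planar G
G-planar = StraightLineDrawing.planar edges (Vec.lookup positions) G (joins⇒∈ edges) positions-general

-- Separation of the corners `u` and `v` by a gadget

cycles : List (List ℕ)
cycles =
    (v ∷ x ∷ s ∷ []) ∷ (v ∷ x′ ∷ s ∷ []) ∷ (u ∷ v ∷ z ∷ []) ∷ (u ∷ v ∷ z′ ∷ []) ∷ (u ∷ y ∷ y′ ∷ [])
  ∷ (u ∷ v ∷ x ∷ y ∷ []) ∷ (u ∷ v ∷ x′ ∷ y′ ∷ []) ∷ (v ∷ x ∷ t ∷ x′ ∷ [])
  ∷ (u ∷ v ∷ x ∷ t ∷ y′ ∷ []) ∷ (u ∷ v ∷ x′ ∷ t ∷ y ∷ [])
  ∷ (10 ∷ 11 ∷ 12 ∷ []) ∷ (13 ∷ 14 ∷ 15 ∷ []) ∷ []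

abstract
  cycles-negative : All (λ i → All (NegativeCycle G ∘ map (embed i)) cycles) (upTo 3)
  cycles-negative = from-yes (all? (λ i → all? (negativeCycle? G ∘ map (embed i)) cycles) (upTo 3))

  triangles-negative : All (λ i → All (All (NegativeCycle G ∘ map (embed i)) ∘ triangles) plants) (upTo 3)
  triangles-negative =
    from-yes (all? (λ i → all? (all? (negativeCycle? G ∘ map (embed i)) ∘ triangles) plants) (upTo 3))

-- A balanced set missing abc but meeting the faces bcp, caq, abr would contain the negative triangle pqr.
octahedron-hit : ∀ (χ : ℕ → Bool) a b c p q r →
  Hit χ (b ∷ p ∷ c ∷ []) → Hit χ (c ∷ q ∷ a ∷ []) → Hit χ (a ∷ r ∷ b ∷ []) → Free χ (p ∷ q ∷ r ∷ []) →
  Hit χ (a ∷ b ∷ c ∷ [])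
octahedron-hit χ a b c p q r bpc cqa arb pqr with χ a | χ b | χ c | χ p | χ q | χ r
... | true  | _     | _     | _    | _    | _    = tt
... | false | true  | _     | _    | _    | _    = tt
... | false | false | true  | _    | _    | _    = tt
... | false | false | false | true | true | true = pqr

-- The negative faces `xyz`, `x′y′z′` and `x′st` are planted directly. The faces `xst` and `yy′t`
-- are positive, so that they are hit is deduced through the octahedra.
gadget-separates : ∀ (χ : ℕ → Bool) → All (Free χ) cycles → All (Hit χ ∘ base) plants → Free χ (u ∷ v ∷ [])
gadget-separates χ (vxs ∷ vx′s ∷ uvz ∷ uvz′ ∷ uyy′ ∷ uvxy ∷ uvx′y′ ∷ vxtx′ ∷ uvxty′ ∷ uvx′ty ∷ o₁ ∷ o₂ ∷ [])
  (xyz ∷ x′y′z′ ∷ x′st ∷ p₁ ∷ p₂ ∷ p₃ ∷ q₁ ∷ q₂ ∷ q₃ ∷ [])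
  = separates (octahedron-hit χ x s t 10 11 12 p₁ p₂ p₃ o₁) (octahedron-hit χ y y′ t 13 14 15 q₁ q₂ q₃ o₂)
  where
  separates : Hit χ (x ∷ s ∷ t ∷ []) → Hit χ (y ∷ y′ ∷ t ∷ []) → Free χ (u ∷ v ∷ [])
  separates xst yy′t with χ u | χ v
  ... | false | _     = tt
  ... | true  | false = tt
  ... | true  | true  with χ z | χ z′
  -- The triangles `uvz` and `uvz′` have excluded `z` and `z′`. Hence exactly one of `x`, `y` and
  -- one of `x′`, `y′` is chosen, by the cycles `uvxy` and `uvx′y′`.
  ...   | false | false with χ y | χ y′ | χ x | χ x′ | χ s | χ t
  -- The pair `y`, `y′` is ruled out by `uyy′`. For `y`, `x′` the cycles `vx′s` and `uvx′ty` exclude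
  -- `s` and `t`, so `xst` is missed. For `x`, `y′` the cycles `vxs` and `uvxty′` do the same, and
  -- `x′st` is missed. For `x`, `x′` the cycle `vxtx′` excludes `t`, so `yy′t` is missed.
  ...     | true  | false | false | true  | false | false = xst
  ...     | false | true  | true  | false | false | false = x′st
  ...     | false | false | true  | true  | _     | false = yy′t

-- The left-hand side is `count χ corners` unfolded, and the hypotheses follow the cyclic order of
-- the sides of the central triangle.
independent : ∀ a b c → T (not (a ∧ b ∧ true)) → T (not (b ∧ c ∧ true)) → T (not (c ∧ a ∧ true)) →
              indicator a + (indicator b + (indicator c + 0)) ≤ 1
independent true  false false _ _ _ = s≤s z≤n
independent false true  false _ _ _ = s≤s z≤n
independent false false true  _ _ _ = s≤s z≤n
independent false false false _ _ _ = z≤n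

-- Weighted count over the three gadgets

cluster : ℕ → List (Fin 72)
cluster i = map (embed i) (concatMap members plants)

-- Repetitions act as weights. With the clusters doubled, a loss of one there weighs two, which pays
-- for two extra corners.
corners weighted-vertices : List (Fin 72)
corners           = map (λ i → embed i u) (upTo 3)
weighted-vertices = corners ++ concatMap cluster (upTo 3) ++ concatMap cluster (upTo 3)

module _ (χ : Fin 72 → Bool) (balanced : Balanced G (T ∘ χ)) where

  free : ∀ i {vs} → NegativeCycle G (map (embed i) vs) → Free (χ ∘ embed i) vs
  free i {vs} = Free-map χ (embed i) vs ∘ avoids-negative G χ balanced

  cluster-count : ∀ i → count χ (cluster i) ≡ sum (map (count (χ ∘ embed i) ∘ members) plants)
  cluster-count i = trans (count-map χ (embed i) (concatMap members plants)) (count-concatMap (χ ∘ embed i) members plants)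

  -- The bound 18 is two for each of the nine plants. When no plant falls short, every planted face
  -- is hit and `gadget-separates` applies.
  clusters-tight : All (Tight (count χ ∘ cluster) 18 (λ i → Free (χ ∘ embed i) (u ∷ v ∷ []))) (upTo 3)
  clusters-tight = All.zipWith (λ {i} (negative-cycles , negative-triangles) →
      Sum.map (Product.map (subst (_≤ 18) (sym (cluster-count i)))
                           (gadget-separates (χ ∘ embed i) (All.map (free i) negative-cycles)))
              (subst (_< 18) (sym (cluster-count i)))
        (sum-tight (All.map (λ {k} → K₄-tight (χ ∘ embed i) k ∘ All.map (free i)) negative-triangles)))
    (cycles-negative , triangles-negative)

  weighted-bound : count χ weighted-vertices ≤ 109
  weighted-bound = begin
    count χ weighted-vertices
      ≡⟨ count-++ χ corners (clusters ++ clusters) ⟩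
    count χ corners + count χ (clusters ++ clusters)
      ≡⟨ cong (count χ corners +_) (count-++ χ clusters clusters) ⟩
    count χ corners + (count χ clusters + count χ clusters)
      ≡⟨ cong (λ m → count χ corners + (m + m)) (count-concatMap χ cluster (upTo 3)) ⟩
    count χ corners + (total + total)
      ≤⟨ bound (sum-tight clusters-tight) ⟩
    109 ∎
    where
    open ℕ.≤-Reasoning
    clusters = concatMap cluster (upTo 3)
    total = sum (map (count χ ∘ cluster) (upTo 3))
    bound : (total ≤ 54 × All (λ i → Free (χ ∘ embed i) (u ∷ v ∷ [])) (upTo 3)) ⊎ total < 54 →
            count χ corners + (total + total) ≤ 109
    bound (inj₁ (total≤54 , f₀ ∷ f₁ ∷ f₂ ∷ [])) =
      ℕ.+-mono-≤ (independent (χ (embed 0 u)) (χ (embed 1 u)) (χ (embed 2 u)) f₀ f₁ f₂) (ℕ.+-mono-≤ total≤54 total≤54)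
    bound (inj₂ (s≤s total≤53)) = ℕ.+-mono-≤ (count≤length χ corners) (ℕ.+-mono-≤ total≤53 total≤53)

theorem1 : Σ ℕ λ n → Σ (SignedGraph n) λ G → Planar G × FracBalChromGt2 G
-- The list has 3 + 2 · 3 · 36 = 219 entries, just one more than 2 · 109, so the strict inequality
-- is reflexivity of `≤`.
theorem1 = 72 , G , G-planar , 219 , 109 , s≤s z≤n , ℕ.≤-refl , fractional-bound G weighted-vertices weighted-bound
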